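{- Let $k\ge 2$, $n>k+2$, and let $P,Q\in\mathfrak P_{k,n}$ be a generic pair of pentagram spirals. If the condition $Q_j\in P_jP_{j+1}$ holds for $2n+1-k$ consecutive values of $j$, then it holds for all $j\in\mathbb Z$.
   Context: $XY$ denotes the line through points $X,Y$. For $k\ge2$, $n>k+2$, $\mathfrak P_{k,n}$ is the set of bi-infinite sequences of points $(P_i)_{i\in\mathbb Z}$ in the projective plane satisfying $P_{i+n}=P_iP_{i+k}\cap P_{i+n-1}P_{i+k-1}$ for all $i$ (pentagram spirals; equivalently $T_k(P)=P$ up to index shift, where $T_k$ is the $k$-diagonal pentagram map). Generic means all points, lines and intersections involved are well defined and in general position. -}

module Defs where

open import Level using (_⊔_)
open import Algebra.Apartness.Bundles using (HeytingField)
open import Data.Integer.Base as ℤ using (ℤ; +_; 0ℤ; 1ℤ)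
open import Data.List.Base using (List; []; _∷_)
open import Data.List.Relation.Unary.All using (All)
open import Data.List.Relation.Unary.AllPairs using (AllPairs)
open import Data.Nat.Base using (ℕ)
open import Data.Product.Base using (_×_; ∃-syntax)
open import Data.Sum.Base using (_⊎_)

-- The projective plane over a field F, in homogeneous coordinates.
module Plane {c ℓ₁ ℓ₂} (F : HeytingField c ℓ₁ ℓ₂) where

  open HeytingField F using (Carrier; _≈_; _#_; _+_; _*_; _-_; 0#)

  record Triple : Set c where
    constructor ⟨_,_,_⟩
    field
      x y z : Carrier

  NonZero : Triple → Set ℓ₂
  NonZero ⟨ x , y , z ⟩ = x # 0# ⊎ y # 0# ⊎ z # 0#

  infix 4 _≈₃_
  _≈₃_ : Triple → Triple → Set ℓ₁
  ⟨ x , y , z ⟩ ≈₃ ⟨ x′ , y′ , z′ ⟩ = x ≈ x′ × y ≈ y′ × z ≈ z′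

  infix 8 _∙_
  _∙_ : Carrier → Triple → Triple
  r ∙ ⟨ x , y , z ⟩ = ⟨ r * x , r * y , r * z ⟩

  infix 7 _·_
  _·_ : Triple → Triple → Carrier
  ⟨ x , y , z ⟩ · ⟨ x′ , y′ , z′ ⟩ = x * x′ + y * y′ + z * z′

  infix 7 _⨯_
  _⨯_ : Triple → Triple → Triple
  ⟨ x , y , z ⟩ ⨯ ⟨ x′ , y′ , z′ ⟩ =
    ⟨ y * z′ - z * y′ , z * x′ - x * z′ , x * y′ - y * x′ ⟩

  -- Homogeneous coordinates [x : y : z] of a point, or the coefficients
  -- of the equation ax + by + cz = 0 of a line.
  record Homogeneous : Set (c ⊔ ℓ₂) where
    constructor homogeneous
    field
      coords  : Triple
      nonZero : NonZero coords

  open Homogeneous public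

  Point Line : Set (c ⊔ ℓ₂)
  Point = Homogeneous
  Line  = Homogeneous

  infix 4 _≐_ _#ₕ_ _on_

  _≐_ : Homogeneous → Homogeneous → Set (c ⊔ ℓ₁ ⊔ ℓ₂)
  X ≐ Y = ∃[ r ] r # 0# × coords X ≈₃ r ∙ coords Y

  -- Distinctness, in the positive form appropriate to a Heyting field:
  -- some 2 × 2 minor of the two coordinate triples is apart from 0.
  _#ₕ_ : Homogeneous → Homogeneous → Set ℓ₂
  X #ₕ Y = NonZero (coords X ⨯ coords Y)

  join : (X Y : Point) → X #ₕ Y → Line
  join X Y X#Y = homogeneous (coords X ⨯ coords Y) X#Y

  meet : (K L : Line) → K #ₕ L → Point
  meet K L K#L = homogeneous (coords K ⨯ coords L) K#L

  _on_ : Point → Line → Set ℓ₁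
  X on L = coords X · coords L ≈ 0#

  -- P (i + n) = P i P (i + k) ∩ P (i + n - 1) P (i + k - 1) for all i, where
  -- the right-hand side is required to be well defined.
  record IsSpiral (k n : ℕ) (P : ℤ → Point) : Set (c ⊔ ℓ₁ ⊔ ℓ₂) where
    field
      diagonal : ∀ i → P i #ₕ P (i ℤ.+ + k)
      transverse : ∀ i → P (i ℤ.+ + n ℤ.- 1ℤ) #ₕ P (i ℤ.+ + k ℤ.- 1ℤ)

    line₁ : ℤ → Line
    line₁ i = join (P i) (P (i ℤ.+ + k)) (diagonal i)

    line₂ : ℤ → Line
    line₂ i = join (P (i ℤ.+ + n ℤ.- 1ℤ)) (P (i ℤ.+ + k ℤ.- 1ℤ)) (transverse i)

    field
      intersecting : ∀ i → line₁ i #ₕ line₂ i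
      recurrence : ∀ i →
        P (i ℤ.+ + n) ≐ meet (line₁ i) (line₂ i) (intersecting i)

  -- In a spiral, P (i + n) and P (i + n + 1) both lie on the line through
  -- P i and P (i + k).  So the side P j P (j + 1) contains P (j + a) for each
  -- a in this list and, dually, P j lies on the sides
  -- P (j - a) P (j - a + 1) for each a in this list.
  offsets : ℕ → ℕ → List ℤ
  offsets k n = 0ℤ ∷ 1ℤ ∷ ℤ.- + n ∷ + k ℤ.- + n ∷ []

  -- The sides are well defined, and of the incidences that the recurrence
  -- forces none is degenerate: the four vertices on each side are pairwise
  -- distinct, and so are the four sides through each vertex.
  record IsGenericSpiral (k n : ℕ) (P : ℤ → Point) : Set (c ⊔ ℓ₁ ⊔ ℓ₂) where
    field
      isSpiral : IsSpiral k n P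
      edge : ∀ j → P j #ₕ P (j ℤ.+ 1ℤ)

    side : ℤ → Line
    side j = join (P j) (P (j ℤ.+ 1ℤ)) (edge j)

    field
      vertices-distinct : ∀ j →
        AllPairs (λ a b → P (j ℤ.+ a) #ₕ P (j ℤ.+ b)) (offsets k n)
      sides-distinct : ∀ j →
        AllPairs (λ a b → side (j ℤ.- a) #ₕ side (j ℤ.- b)) (offsets k n)

  -- Two generic spirals in general position with respect to each other:
  -- Q j differs from the four vertices of P on the side P j P (j + 1), and
  -- that side differs from the four sides of Q through Q j.  Both are
  -- compatible with Q j lying on the side P j P (j + 1); they exclude pairs
  -- such as Q j = P (j + 1).
  record IsGenericPair (k n : ℕ) (P Q : ℤ → Point) : Set (c ⊔ ℓ₁ ⊔ ℓ₂) where
    field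
      genericP : IsGenericSpiral k n P
      genericQ : IsGenericSpiral k n Q

    open IsGenericSpiral genericP public using () renaming (side to sideP)
    open IsGenericSpiral genericQ public using () renaming (side to sideQ)

    field
      vertices-apart : ∀ j → All (λ a → Q j #ₕ P (j ℤ.+ a)) (offsets k n)
      sides-apart : ∀ j → All (λ a → sideP j #ₕ sideQ (j ℤ.- a)) (offsets k n)

module Submission where

-- Let q j be the side Q j Q (j + 1), and let a , b , c , d be the four offsets
-- 0 , 1 , - n , k - n.  The lines q (e + a) , ... , q (e + d) form a complete
-- quadrilateral with vertices Q (e + x + y), and the points P (f - a) , ... ,
-- P (f - d), where f = e + a + b + c + d, form a complete quadrangle with sides
-- P j P (j + 1) for the same six indices j = e + x + y.  If five vertices of a
-- quadrilateral lie on the corresponding sides of a quadrangle, so does the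
-- sixth: each incidence says that a 2 × 2 minor of the matrix of pairings
-- between the lines and the points vanishes, and the product of the six ratios
-- of the terms of these minors, with suitable signs in the exponents, is 1.
-- The largest and the smallest of the six indices are e + 0 + 1 and
-- e - n + (k - n), which differ by 2 n + 1 - k, so a window of 2 n + 1 - k
-- consecutive incidences can be shifted by one in either direction.

import Algebra.Properties.Group as GroupProperties
import Algebra.Properties.Ring as RingProperties
import Algebra.Properties.Semiring.Mult as Multiples
import Algebra.Solver.Ring
import Data.Integer.Properties as ℤ
import Data.Maybe.Base as Maybe
import Data.Nat.Properties as ℕ
import Data.Nat.Tactic.RingSolver as ℕ-Solver
import Level
import Relation.Binary.Reasoning.Setoid as SetoidReasoning
open import Defs
open import Algebra.Apartness.Bundles using (HeytingField; HeytingCommutativeRing)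
open import Algebra.Apartness.Properties.HeytingCommutativeRing
  using (x-0≈x; x#0y#0→xy#0; #-congʳ; invertibleˡ⇒#)
open import Algebra.Bundles using (CommutativeRing)
open import Algebra.Solver.Ring.AlmostCommutativeRing
  using (fromCommutativeRing; _-Raw-AlmostCommutative⟶_)
open import Data.Integer.Base as ℤ using (ℤ; +_; -[1+_]; 0ℤ; 1ℤ)
open import Data.Integer.Tactic.RingSolver using (solve-∀)
open import Data.List.Base using ([]; _∷_)
open import Data.List.Relation.Unary.All as All using (All; []; _∷_)
open import Data.List.Relation.Unary.AllPairs as AllPairs using (AllPairs; []; _∷_)
open import Data.Nat.Base as ℕ using (ℕ; zero; suc; z≤n; s≤s)
open import Data.Product.Base using (_×_; _,_; ∃-syntax; proj₁; proj₂)
open import Data.Sum.Base as Sum using (_⊎_; inj₁; inj₂)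
open import Function.Bundles using (_⇔_; mk⇔; Equivalence)
open import Relation.Binary.Consequences using (dec⇒weaklyDec)
open import Relation.Binary.PropositionalEquality as ≡ using (_≡_; subst; subst₂)

-- The canonical homomorphism from the integers to a commutative ring.

-- Equality in R is not decidable, so a ring solver with coefficients in R cannot
-- cancel x - x; with coefficients in ℤ it can.
module IntegerCoefficients {c ℓ} (R : CommutativeRing c ℓ) where

  open CommutativeRing R hiding (zero)
  open RingProperties ring
  open Multiples semiring using (×-homo-+; ×1-homo-*) renaming (_×_ to _⋆_)
  open SetoidReasoning setoid

  ⟦_⟧ : ℤ → Carrier
  ⟦ + n ⟧      = n ⋆ 1#
  ⟦ -[1+ n ] ⟧ = - (suc n ⋆ 1#)

  ⟦⟧-homo-neg : ∀ i → ⟦ ℤ.- i ⟧ ≈ - ⟦ i ⟧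
  ⟦⟧-homo-neg (+ zero)   = sym -0#≈0#
  ⟦⟧-homo-neg (+ suc n)  = refl
  ⟦⟧-homo-neg -[1+ n ]   = sym (-‿involutive _)

  -- Stripping `suc` from both arguments is matched in the ring by inserting `1# - 1#` and sharing
  -- it between the two terms.
  ⟦⟧-homo-⊖ : ∀ m n → ⟦ m ℤ.⊖ n ⟧ ≈ m ⋆ 1# - n ⋆ 1#
  ⟦⟧-homo-⊖ m       zero    = sym (trans (+-congˡ -0#≈0#) (+-identityʳ _))
  ⟦⟧-homo-⊖ zero    (suc n) = sym (+-identityˡ _)
  ⟦⟧-homo-⊖ (suc m) (suc n) = begin
    ⟦ suc m ℤ.⊖ suc n ⟧                    ≡⟨ ≡.cong ⟦_⟧ (ℤ.[1+m]⊖[1+n]≡m⊖n m n) ⟩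
    ⟦ m ℤ.⊖ n ⟧                            ≈⟨ ⟦⟧-homo-⊖ m n ⟩
    m ⋆ 1# - n ⋆ 1#                        ≈⟨ +-congʳ (+-identityʳ _) ⟨
    m ⋆ 1# + 0# - n ⋆ 1#                   ≈⟨ +-congʳ (+-congˡ (-‿inverseʳ 1#)) ⟨
    m ⋆ 1# + (1# - 1#) - n ⋆ 1#            ≈⟨ +-congʳ (+-assoc _ _ _) ⟨
    m ⋆ 1# + 1# - 1# - n ⋆ 1#              ≈⟨ +-assoc _ _ _ ⟩
    m ⋆ 1# + 1# + (- 1# - n ⋆ 1#)          ≈⟨ +-cong (+-comm _ _) (-‿+-comm _ _) ⟩
    1# + m ⋆ 1# - (1# + n ⋆ 1#)            ∎

  ⟦⟧-homo-+ : ∀ i j → ⟦ i ℤ.+ j ⟧ ≈ ⟦ i ⟧ + ⟦ j ⟧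
  ⟦⟧-homo-+ (+ m)    (+ n)    = ×-homo-+ 1# m n
  ⟦⟧-homo-+ (+ m)    -[1+ n ] = ⟦⟧-homo-⊖ m (suc n)
  ⟦⟧-homo-+ -[1+ m ] (+ n)    = trans (⟦⟧-homo-⊖ n (suc m)) (+-comm _ _)
  ⟦⟧-homo-+ -[1+ m ] -[1+ n ] = begin
    - (suc (suc (m ℕ.+ n)) ⋆ 1#)     ≡⟨ ≡.cong (λ l → - (suc l ⋆ 1#)) (ℕ.+-suc m n) ⟨
    - ((suc m ℕ.+ suc n) ⋆ 1#)       ≈⟨ -‿cong (×-homo-+ 1# (suc m) (suc n)) ⟩
    - (suc m ⋆ 1# + suc n ⋆ 1#)      ≈⟨ -‿+-comm _ _ ⟨
    - (suc m ⋆ 1#) - suc n ⋆ 1#      ∎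

  ⟦⟧-homo-*₊ : ∀ m n → ⟦ + m ℤ.* + n ⟧ ≈ ⟦ + m ⟧ * ⟦ + n ⟧
  ⟦⟧-homo-*₊ m n = trans (reflexive (≡.cong ⟦_⟧ (≡.sym (ℤ.pos-* m n)))) (×1-homo-* m n)

  ⟦⟧-homo-*₊ʳ : ∀ i n → ⟦ i ℤ.* + n ⟧ ≈ ⟦ i ⟧ * ⟦ + n ⟧
  ⟦⟧-homo-*₊ʳ (+ m)    n = ⟦⟧-homo-*₊ m n
  ⟦⟧-homo-*₊ʳ -[1+ m ] n = begin
    ⟦ -[1+ m ] ℤ.* + n ⟧         ≡⟨ ≡.cong ⟦_⟧ (ℤ.neg-distribˡ-* (+ suc m) (+ n)) ⟨
    ⟦ ℤ.- (+ suc m ℤ.* + n) ⟧    ≈⟨ ⟦⟧-homo-neg (+ suc m ℤ.* + n) ⟩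
    - ⟦ + suc m ℤ.* + n ⟧        ≈⟨ -‿cong (⟦⟧-homo-*₊ (suc m) n) ⟩
    - (⟦ + suc m ⟧ * ⟦ + n ⟧)    ≈⟨ -‿distribˡ-* _ _ ⟩
    - ⟦ + suc m ⟧ * ⟦ + n ⟧      ∎

  ⟦⟧-homo-* : ∀ i j → ⟦ i ℤ.* j ⟧ ≈ ⟦ i ⟧ * ⟦ j ⟧
  ⟦⟧-homo-* i (+ n)    = ⟦⟧-homo-*₊ʳ i n
  ⟦⟧-homo-* i -[1+ n ] = begin
    ⟦ i ℤ.* -[1+ n ] ⟧           ≡⟨ ≡.cong ⟦_⟧ (ℤ.neg-distribʳ-* i (+ suc n)) ⟨
    ⟦ ℤ.- (i ℤ.* + suc n) ⟧      ≈⟨ ⟦⟧-homo-neg (i ℤ.* + suc n) ⟩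
    - ⟦ i ℤ.* + suc n ⟧          ≈⟨ -‿cong (⟦⟧-homo-*₊ʳ i (suc n)) ⟩
    - (⟦ i ⟧ * ⟦ + suc n ⟧)      ≈⟨ -‿distribʳ-* _ _ ⟩
    ⟦ i ⟧ * - ⟦ + suc n ⟧        ∎

  homomorphism : CommutativeRing.rawRing ℤ.+-*-commutativeRing
                   -Raw-AlmostCommutative⟶ fromCommutativeRing R
  homomorphism = record
    { ⟦_⟧    = ⟦_⟧
    ; +-homo = ⟦⟧-homo-+
    ; *-homo = ⟦⟧-homo-*
    ; -‿homo = ⟦⟧-homo-neg
    ; 0-homo = refl
    ; 1-homo = +-identityʳ 1#
    }

  open Algebra.Solver.Ring _ _ homomorphism
    (λ i j → Maybe.map (λ i≡j → reflexive (≡.cong ⟦_⟧ i≡j)) (dec⇒weaklyDec ℤ._≟_ i j))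
    public using (solve; _:=_; _:+_; _:*_; _:-_; :-_; con)

-- Incidence in homogeneous coordinates over a Heyting field.

module Projective {c ℓ₁ ℓ₂} (F : HeytingField c ℓ₁ ℓ₂) where

  open Plane F renaming (_·_ to infix 8 _·_; _⨯_ to infix 9 _⨯_)
  open HeytingField F hiding (zero)
  private
    H = heytingCommutativeRing
    R = HeytingCommutativeRing.commutativeRing H
  open RingProperties (CommutativeRing.ring R) using (-0#≈0#)
  open GroupProperties (CommutativeRing.+-group R) using ()
    renaming (x∙y⁻¹≈ε⇒x≈y to x-y≈0⇒x≈y; x≈y⇒x∙y⁻¹≈ε to x≈y⇒x-y≈0)
  open IntegerCoefficients R using (solve; _:=_; _:+_; _:*_; _:-_; :-_; con)
  open SetoidReasoning (CommutativeRing.setoid R)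

  *-cancel-# : ∀ {x y} → x # 0# → x * y ≈ 0# → y ≈ 0#
  *-cancel-# {x} {y} x#0 xy≈0 with x⁻¹ , x⁻¹x≈1 , _ ← #⇒invertible x#0 = begin
    y                         ≈⟨ *-identityˡ y ⟨
    1# * y                    ≈⟨ *-congʳ x⁻¹x≈1 ⟨
    -- Apartness from zero provides an inverse of the difference `x - 0#`.
    x⁻¹ * (x - 0#) * y        ≈⟨ *-congʳ (*-congˡ (x-0≈x H x)) ⟩
    x⁻¹ * x * y               ≈⟨ *-assoc _ _ _ ⟩
    x⁻¹ * (x * y)             ≈⟨ *-congˡ xy≈0 ⟩
    x⁻¹ * 0#                  ≈⟨ zeroʳ x⁻¹ ⟩
    0#                        ∎

  -- If `w` inverts `x * y`, then `w * x` inverts `y`.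
  *-#0⇒#0ʳ : ∀ {x y} → x * y # 0# → y # 0#
  *-#0⇒#0ʳ {x} {y} xy#0 with w , w[xy]≈1 , _ ← #⇒invertible xy#0 =
    invertibleˡ⇒# H (w * x , (begin
      w * x * (y - 0#)          ≈⟨ *-congˡ (x-0≈x H y) ⟩
      w * x * y                 ≈⟨ *-assoc _ _ _ ⟩
      w * (x * y)               ≈⟨ *-congˡ (x-0≈x H (x * y)) ⟨
      w * (x * y - 0#)          ≈⟨ w[xy]≈1 ⟩
      1#                        ∎))

  -- A unit vector selects the coordinate apart from zero, which trades the disjunction for a single
  -- scalar that can be cancelled.
  NonZero⇒·#0 : ∀ U → NonZero U → ∃[ V ] U · V # 0#
  NonZero⇒·#0 ⟨ x , y , z ⟩ (inj₁ x#0) = ⟨ 1# , 0# , 0# ⟩ , #-congʳ H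
    (sym (trans (+-cong (+-cong (*-identityʳ x) (zeroʳ y)) (zeroʳ z)) (trans (+-identityʳ _) (+-identityʳ x)))) x#0
  NonZero⇒·#0 ⟨ x , y , z ⟩ (inj₂ (inj₁ y#0)) = ⟨ 0# , 1# , 0# ⟩ , #-congʳ H
    (sym (trans (+-cong (+-cong (zeroʳ x) (*-identityʳ y)) (zeroʳ z)) (trans (+-identityʳ _) (+-identityˡ y)))) y#0
  NonZero⇒·#0 ⟨ x , y , z ⟩ (inj₂ (inj₂ z#0)) = ⟨ 0# , 0# , 1# ⟩ , #-congʳ H
    (sym (trans (+-cong (+-cong (zeroʳ x) (zeroʳ y)) (*-identityʳ z)) (trans (+-congʳ (+-identityʳ 0#)) (+-identityˡ z)))) z#0

  ·-comm : ∀ U V → U · V ≈ V · U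
  ·-comm ⟨ _ , _ , _ ⟩ ⟨ _ , _ , _ ⟩ =
    +-cong (+-cong (*-comm _ _) (*-comm _ _)) (*-comm _ _)

  ·-congˡ : ∀ {U V} W → U ≈₃ V → W · U ≈ W · V
  ·-congˡ {⟨ _ , _ , _ ⟩} {⟨ _ , _ , _ ⟩} ⟨ _ , _ , _ ⟩ (x , y , z) =
    +-cong (+-cong (*-congˡ x) (*-congˡ y)) (*-congˡ z)

  ·-∙ : ∀ W r U → W · (r ∙ U) ≈ r * (W · U)
  ·-∙ ⟨ a , b , c ⟩ r ⟨ x , y , z ⟩ = solve 7 (λ a b c r x y z →
    a :* (r :* x) :+ b :* (r :* y) :+ c :* (r :* z) := r :* (a :* x :+ b :* y :+ c :* z)) refl a b c r x y z

  binet-cauchy : ∀ U L V W →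
    (U ⨯ L) · (V ⨯ W) ≈ (U · V) * (L · W) - (U · W) * (L · V)
  binet-cauchy ⟨ u₁ , u₂ , u₃ ⟩ ⟨ l₁ , l₂ , l₃ ⟩ ⟨ v₁ , v₂ , v₃ ⟩ ⟨ w₁ , w₂ , w₃ ⟩ =
    solve 12 (λ u₁ u₂ u₃ l₁ l₂ l₃ v₁ v₂ v₃ w₁ w₂ w₃ →
      (u₂ :* l₃ :- u₃ :* l₂) :* (v₂ :* w₃ :- v₃ :* w₂)
        :+ (u₃ :* l₁ :- u₁ :* l₃) :* (v₃ :* w₁ :- v₁ :* w₃)
        :+ (u₁ :* l₂ :- u₂ :* l₁) :* (v₁ :* w₂ :- v₂ :* w₁)
      := (u₁ :* v₁ :+ u₂ :* v₂ :+ u₃ :* v₃) :* (l₁ :* w₁ :+ l₂ :* w₂ :+ l₃ :* w₃)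
        :- (u₁ :* w₁ :+ u₂ :* w₂ :+ u₃ :* w₃) :* (l₁ :* v₁ :+ l₂ :* v₂ :+ l₃ :* v₃))
      refl u₁ u₂ u₃ l₁ l₂ l₃ v₁ v₂ v₃ w₁ w₂ w₃

  triple-product : ∀ U V W → (U ⨯ V) · W ≈ U · (V ⨯ W)
  triple-product ⟨ u₁ , u₂ , u₃ ⟩ ⟨ v₁ , v₂ , v₃ ⟩ ⟨ w₁ , w₂ , w₃ ⟩ =
    solve 9 (λ u₁ u₂ u₃ v₁ v₂ v₃ w₁ w₂ w₃ →
      (u₂ :* v₃ :- u₃ :* v₂) :* w₁ :+ (u₃ :* v₁ :- u₁ :* v₃) :* w₂ :+ (u₁ :* v₂ :- u₂ :* v₁) :* w₃
      := u₁ :* (v₂ :* w₃ :- v₃ :* w₂) :+ u₂ :* (v₃ :* w₁ :- v₁ :* w₃) :+ u₃ :* (v₁ :* w₂ :- v₂ :* w₁))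
      refl u₁ u₂ u₃ v₁ v₂ v₃ w₁ w₂ w₃

  ·⨯-swap : ∀ U V W → U · (V ⨯ W) ≈ - (V · (U ⨯ W))
  ·⨯-swap ⟨ u₁ , u₂ , u₃ ⟩ ⟨ v₁ , v₂ , v₃ ⟩ ⟨ w₁ , w₂ , w₃ ⟩ =
    solve 9 (λ u₁ u₂ u₃ v₁ v₂ v₃ w₁ w₂ w₃ →
      u₁ :* (v₂ :* w₃ :- v₃ :* w₂) :+ u₂ :* (v₃ :* w₁ :- v₁ :* w₃) :+ u₃ :* (v₁ :* w₂ :- v₂ :* w₁)
      := :- (v₁ :* (u₂ :* w₃ :- u₃ :* w₂) :+ v₂ :* (u₃ :* w₁ :- u₁ :* w₃) :+ v₃ :* (u₁ :* w₂ :- u₂ :* w₁)))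
      refl u₁ u₂ u₃ v₁ v₂ v₃ w₁ w₂ w₃

  ·⨯-cycle : ∀ U V W → U · (V ⨯ W) ≈ W · (U ⨯ V)
  ·⨯-cycle U V W = trans (sym (triple-product U V W)) (·-comm (U ⨯ V) W)

  U·U⨯V≈0 : ∀ U V → U · (U ⨯ V) ≈ 0#
  U·U⨯V≈0 ⟨ u₁ , u₂ , u₃ ⟩ ⟨ v₁ , v₂ , v₃ ⟩ =
    solve 6 (λ u₁ u₂ u₃ v₁ v₂ v₃ →
      u₁ :* (u₂ :* v₃ :- u₃ :* v₂) :+ u₂ :* (u₃ :* v₁ :- u₁ :* v₃) :+ u₃ :* (u₁ :* v₂ :- u₂ :* v₁)
      := con 0ℤ) refl u₁ u₂ u₃ v₁ v₂ v₃

  V·U⨯V≈0 : ∀ U V → V · (U ⨯ V) ≈ 0#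
  V·U⨯V≈0 ⟨ u₁ , u₂ , u₃ ⟩ ⟨ v₁ , v₂ , v₃ ⟩ =
    solve 6 (λ u₁ u₂ u₃ v₁ v₂ v₃ →
      v₁ :* (u₂ :* v₃ :- u₃ :* v₂) :+ v₂ :* (u₃ :* v₁ :- u₁ :* v₃) :+ v₃ :* (u₁ :* v₂ :- u₂ :* v₁)
      := con 0ℤ) refl u₁ u₂ u₃ v₁ v₂ v₃

  collinear-swap : ∀ U V W → U · (V ⨯ W) ≈ 0# → V · (U ⨯ W) ≈ 0#
  collinear-swap U V W e = trans (·⨯-swap V U W) (trans (-‿cong e) -0#≈0#)

  ⨯-NonZero-sym : ∀ U V → NonZero (U ⨯ V) → NonZero (V ⨯ U)
  ⨯-NonZero-sym ⟨ u₁ , u₂ , u₃ ⟩ ⟨ v₁ , v₂ , v₃ ⟩ =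
    Sum.map (flip u₂ v₃ u₃ v₂) (Sum.map (flip u₃ v₁ u₁ v₃) (flip u₁ v₂ u₂ v₁))
    where
    flip : ∀ a b c d → a * b - c * d # 0# → d * c - b * a # 0#
    flip a b c d e#0 = *-#0⇒#0ʳ (#-congʳ H
      (solve 4 (λ a b c d → a :* b :- c :* d := :- con 1ℤ :* (d :* c :- b :* a)) refl a b c d) e#0)

  module _ {X Y L : Triple} (X·L≈0 : X · L ≈ 0#) (Y·L≈0 : Y · L ≈ 0#) where

    -- `(X ⨯ Y) ⨯ L` expands into multiples of `X · L` and `Y · L`, so it vanishes; pairing it with
    -- `V ⨯ W` gives proportionality in cross-multiplied form.
    ⨯-proportional : ∀ V W → (X ⨯ Y) · V * (L · W) ≈ (X ⨯ Y) · W * (L · V)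
    ⨯-proportional V W = x-y≈0⇒x≈y _ _ (begin
      (X ⨯ Y) · V * (L · W) - (X ⨯ Y) · W * (L · V)  ≈⟨ binet-cauchy (X ⨯ Y) L V W ⟨
      ((X ⨯ Y) ⨯ L) · (V ⨯ W)                        ≈⟨ triple-product (X ⨯ Y) L (V ⨯ W) ⟩
      (X ⨯ Y) · (L ⨯ (V ⨯ W))                        ≈⟨ binet-cauchy X Y L (V ⨯ W) ⟩
      X · L * (Y · (V ⨯ W)) - X · (V ⨯ W) * (Y · L)  ≈⟨ +-cong (*-congʳ X·L≈0) (-‿cong (*-congˡ Y·L≈0)) ⟩
      0# * (Y · (V ⨯ W)) - X · (V ⨯ W) * 0#          ≈⟨ +-cong (zeroˡ _) (trans (-‿cong (zeroʳ _)) -0#≈0#) ⟩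
      0# + 0#                                        ≈⟨ +-identityˡ 0# ⟩
      0#                                             ∎)

    -- Nonzero proportional triples annihilate the same points: `V` is chosen to pair with one of
    -- them to a scalar that can be cancelled.
    same-line : NonZero (X ⨯ Y) → NonZero L → ∀ W → W · (X ⨯ Y) ≈ 0# ⇔ W · L ≈ 0#
    same-line X#Y L≠0 W = mk⇔ to from
      where
      to : W · (X ⨯ Y) ≈ 0# → W · L ≈ 0#
      to W·U≈0 with V , U·V#0 ← NonZero⇒·#0 (X ⨯ Y) X#Y =
        trans (·-comm W L) (*-cancel-# U·V#0 (begin
          (X ⨯ Y) · V * (L · W)   ≈⟨ ⨯-proportional V W ⟩
          (X ⨯ Y) · W * (L · V)   ≈⟨ *-congʳ (trans (·-comm (X ⨯ Y) W) W·U≈0) ⟩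
          0# * (L · V)            ≈⟨ zeroˡ _ ⟩
          0#                      ∎))

      from : W · L ≈ 0# → W · (X ⨯ Y) ≈ 0#
      from W·L≈0 with V , L·V#0 ← NonZero⇒·#0 L L≠0 =
        trans (·-comm W (X ⨯ Y)) (*-cancel-# L·V#0 (begin
          L · V * ((X ⨯ Y) · W)   ≈⟨ *-comm _ _ ⟩
          (X ⨯ Y) · W * (L · V)   ≈⟨ ⨯-proportional V W ⟨
          (X ⨯ Y) · V * (L · W)   ≈⟨ *-congˡ (trans (·-comm L W) W·L≈0) ⟩
          (X ⨯ Y) · V * 0#        ≈⟨ zeroʳ _ ⟩
          0#                      ∎))

    -- The distinct lines `L` and `K` meet only in `X`, so the other point `Y` of `L` is off `K`.
    -- Apartness is obtained positively, with `K · Y` as a factor of a product apart from zero.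
    off-second-line : ∀ K → NonZero (X ⨯ Y) → NonZero (L ⨯ K) → X · K ≈ 0# → K · Y # 0#
    off-second-line K X#Y L#K X·K≈0
      with B , U·B#0 ← NonZero⇒·#0 (X ⨯ Y) X#Y
         | A , LK·A#0 ← NonZero⇒·#0 (L ⨯ K) L#K =
      *-#0⇒#0ʳ (#-congʳ H eq (x#0y#0→xy#0 H U·B#0 LK·A#0))
      where
      eq : (X ⨯ Y) · B * ((L ⨯ K) · A) ≈ - (X · A * (L · B)) * (K · Y)
      eq = begin
        (X ⨯ Y) · B * ((L ⨯ K) · A)                         ≈⟨ *-congˡ (triple-product L K A) ⟩
        (X ⨯ Y) · B * (L · (K ⨯ A))                         ≈⟨ ⨯-proportional B (K ⨯ A) ⟩
        (X ⨯ Y) · (K ⨯ A) * (L · B)                         ≈⟨ *-congʳ (binet-cauchy X Y K A) ⟩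
        (X · K * (Y · A) - X · A * (Y · K)) * (L · B)
          ≈⟨ *-congʳ (+-cong (*-congʳ X·K≈0) (-‿cong (*-congˡ (·-comm Y K)))) ⟩
        (0# * (Y · A) - X · A * (K · Y)) * (L · B)
          ≈⟨ solve 4 (λ ya xa ky lb → (con 0ℤ :* ya :- xa :* ky) :* lb := :- (xa :* lb) :* ky)
               refl (Y · A) (X · A) (K · Y) (L · B) ⟩
        - (X · A * (L · B)) * (K · Y)                       ∎

  -- `K ⨯ K′` represents the point `Q` and `X ⨯ Y` the line `L`, so incidence means that
  -- `(K ⨯ K′) · (X ⨯ Y)` vanishes; `binet-cauchy` expands this into the minor.
  incident⇔minor : ∀ {K K′ Q X Y L : Triple} →
    NonZero (K ⨯ K′) → NonZero (X ⨯ Y) → NonZero Q → NonZero L →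
    Q · K ≈ 0# → Q · K′ ≈ 0# → X · L ≈ 0# → Y · L ≈ 0# →
    Q · L ≈ 0# ⇔ K · X * (K′ · Y) ≈ K · Y * (K′ · X)
  incident⇔minor {K} {K′} {Q} {X} {Y} {L} K#K′ X#Y Q≠0 L≠0 Q·K≈0 Q·K′≈0 X·L≈0 Y·L≈0 = mk⇔
    (λ Q·L≈0 → x-y≈0⇒x≈y _ _ (begin
      K · X * (K′ · Y) - K · Y * (K′ · X)   ≈⟨ binet-cauchy K K′ X Y ⟨
      (K ⨯ K′) · (X ⨯ Y)                    ≈⟨ ·-comm (K ⨯ K′) (X ⨯ Y) ⟩
      (X ⨯ Y) · (K ⨯ K′)                    ≈⟨ pencil.from (trans (·-comm (X ⨯ Y) Q) (line.from Q·L≈0)) ⟩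
      0#                                    ∎))
    (λ minor → line.to (trans (·-comm Q (X ⨯ Y)) (pencil.to (begin
      (X ⨯ Y) · (K ⨯ K′)                    ≈⟨ ·-comm (X ⨯ Y) (K ⨯ K′) ⟩
      (K ⨯ K′) · (X ⨯ Y)                    ≈⟨ binet-cauchy K K′ X Y ⟩
      K · X * (K′ · Y) - K · Y * (K′ · X)   ≈⟨ x≈y⇒x-y≈0 minor ⟩
      0#                                    ∎))))
    where
    -- The dual use of `same-line`: `K` and `K′` act as points, `Q` as the line through them.
    module pencil = Equivalence
      (same-line (trans (·-comm K Q) Q·K≈0) (trans (·-comm K′ Q) Q·K′≈0) K#K′ Q≠0 (X ⨯ Y))
    module line = Equivalence (same-line X·L≈0 Y·L≈0 X#Y L≠0 Q)

  -- With M xy = (z xu * z yv) / (z xv * z yu), where {u , v} is the complement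
  -- of {x , y} in {a , b , c , d}, this is M ab * M cd * M ad * M bc = M ac * M bd.
  sixth-minor : ∀ {ab ac ad ba bc bd ca cb cd da db dc : Carrier} →
    cb # 0# → da # 0# →
    ca * db ≈ cb * da → ba * dc ≈ bc * da → ab * cd ≈ ad * cb →
    ab * dc ≈ ac * db → ba * cd ≈ bd * ca →
    ac * bd ≈ ad * bc
  sixth-minor {ab} {ac} {ad} {ba} {bc} {bd} {ca} {cb} {cd} {da} {db} {dc}
    cb#0 da#0 Mcd Mbd Mac Mad Mbc = x-y≈0⇒x≈y _ _ (*-cancel-# (x#0y#0→xy#0 H cb#0 da#0) (begin
      -- Combining the five relations without division leaves `cb * da` as the factor to cancel.
      cb * da * (ac * bd - ad * bc)
        ≈⟨ solve 6 (λ ac ad bc bd cb da →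
             cb :* da :* (ac :* bd :- ad :* bc) := ac :* bd :* (cb :* da) :- ad :* cb :* (bc :* da))
             refl ac ad bc bd cb da ⟩
      ac * bd * (cb * da) - ad * cb * (bc * da)        ≈⟨ +-cong (*-congˡ (sym Mcd)) (-‿cong (*-cong (sym Mac) (sym Mbd))) ⟩
      ac * bd * (ca * db) - ab * cd * (ba * dc)
        ≈⟨ solve 8 (λ ac bd ca db ab cd ba dc →
             ac :* bd :* (ca :* db) :- ab :* cd :* (ba :* dc)
               := ac :* db :* (bd :* ca) :- ab :* dc :* (ba :* cd))
             refl ac bd ca db ab cd ba dc ⟩
      ac * db * (bd * ca) - ab * dc * (ba * cd)        ≈⟨ +-cong (*-cong (sym Mad) (sym Mbc)) refl ⟩
      ab * dc * (ba * cd) - ab * dc * (ba * cd)        ≈⟨ -‿inverseʳ _ ⟩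
      0#                                               ∎))

-- Genericity is given index by index; moving the quantifier inside the list yields, for each pair
-- of offsets, one fact uniform in the index.
allPairs-∀ : ∀ {a ℓ i} {A : Set a} {I : Set i} {R : I → A → A → Set ℓ} {xs} →
             (∀ i → AllPairs (R i) xs) → AllPairs (λ x y → ∀ i → R i x y) xs
allPairs-∀ {xs = []}     _  = []
allPairs-∀ {xs = _ ∷ _} Rs =
  All.tabulate (λ y∈xs i → All.lookup (AllPairs.head (Rs i)) y∈xs)
    ∷ allPairs-∀ (λ i → AllPairs.tail (Rs i))

all-∀ : ∀ {a ℓ i} {A : Set a} {I : Set i} {R : I → A → Set ℓ} {xs} →
        (∀ i → All (R i) xs) → All (λ x → ∀ i → R i x) xs
all-∀ Rs = All.tabulate (λ x∈xs i → All.lookup (Rs i) x∈xs)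

module Spirals {c ℓ₁ ℓ₂} (F : HeytingField c ℓ₁ ℓ₂) where

  open HeytingField F using (Carrier; 0#; _≈_; _#_; _*_; trans; sym; *-congˡ; zeroʳ)
  open Plane F renaming (_·_ to infix 8 _·_; _⨯_ to infix 9 _⨯_)
  open Projective F

  -- Incidences within a single spiral.

  module Incidences {k n : ℕ} {P : ℤ → Point} (generic : IsGenericSpiral k n P) where

    open IsGenericSpiral generic
    open IsSpiral isSpiral

    p : ℤ → Triple
    p j = coords (P j)

    Collinear : ℤ → ℤ → ℤ → Set ℓ₁
    Collinear x y z = p x · (p y ⨯ p z) ≈ 0#

    on-meet : ∀ {X K L} (K#L : K #ₕ L) → X ≐ meet K L K#L → X on K × X on L
    on-meet {X} {K} {L} K#L (r , _ , X≈) =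
      on (coords K) (U·U⨯V≈0 (coords K) (coords L)) , on (coords L) (V·U⨯V≈0 (coords K) (coords L))
      where
      on : ∀ W → W · (coords K ⨯ coords L) ≈ 0# → coords X · W ≈ 0#
      on W e = trans (·-comm (coords X) W) (trans (·-congˡ W X≈)
        (trans (·-∙ W r (coords K ⨯ coords L)) (trans (*-congˡ e) (zeroʳ r))))

    -- The first line of the recurrence at index `j - n`.
    collinear₁ : ∀ j → Collinear j (j ℤ.- + n) (j ℤ.+ (+ k ℤ.- + n))
    collinear₁ j = subst₂ (λ x z → Collinear x (j ℤ.- + n) z) (eq₁ j (+ n)) (eq₂ j (+ k) (+ n))
      (proj₁ (on-meet {P (i ℤ.+ + n)} {line₁ i} {line₂ i} (intersecting i) (recurrence i)))
      where
      i = j ℤ.- + n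
      eq₁ : ∀ j n → j ℤ.- n ℤ.+ n ≡ j
      eq₁ = solve-∀
      eq₂ : ∀ j k n → j ℤ.- n ℤ.+ k ≡ j ℤ.+ (k ℤ.- n)
      eq₂ = solve-∀

    -- The second line of the recurrence at index `j - n + 1`, which constructs `P (j + 1)`.
    collinear₂ : ∀ j → Collinear (j ℤ.+ 1ℤ) j (j ℤ.+ (+ k ℤ.- + n))
    collinear₂ j = subst₂ (λ x z → Collinear x j z) (eq₁ j (+ n)) (eq₃ j (+ k) (+ n))
      (subst (λ y → Collinear (i ℤ.+ + n) y (i ℤ.+ + k ℤ.- 1ℤ)) (eq₂ j (+ n))
        (proj₂ (on-meet {P (i ℤ.+ + n)} {line₁ i} {line₂ i} (intersecting i) (recurrence i))))
      where
      i = j ℤ.- + n ℤ.+ 1ℤ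
      eq₁ : ∀ j n → j ℤ.- n ℤ.+ 1ℤ ℤ.+ n ≡ j ℤ.+ 1ℤ
      eq₁ = solve-∀
      eq₂ : ∀ j n → j ℤ.- n ℤ.+ 1ℤ ℤ.+ n ℤ.- 1ℤ ≡ j
      eq₂ = solve-∀
      eq₃ : ∀ j k n → j ℤ.- n ℤ.+ 1ℤ ℤ.+ k ℤ.- 1ℤ ≡ j ℤ.+ (k ℤ.- n)
      eq₃ = solve-∀

    -- By `collinear₂` the side is also the line through `P j` and `P (j + k - n)`, and `collinear₁`
    -- places `P (j - n)` on that line.
    vertices-on-side : ∀ j → All (λ a → P (j ℤ.+ a) on side j) (offsets k n)
    vertices-on-side j with vertices-distinct j
    ... | (_ ∷ _ ∷ 0#k-n ∷ []) ∷ _ = P₀ ∷ P₁ ∷ P₋ₙ ∷ Pₖ₋ₙ ∷ []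
      where
      l = j ℤ.+ (+ k ℤ.- + n)
      P₀ : P (j ℤ.+ 0ℤ) on side j
      P₀ = subst (λ x → P x on side j) (≡.sym (ℤ.+-identityʳ j)) (U·U⨯V≈0 (p j) (p (j ℤ.+ 1ℤ)))
      P₁ : P (j ℤ.+ 1ℤ) on side j
      P₁ = V·U⨯V≈0 (p j) (p (j ℤ.+ 1ℤ))
      Pₖ₋ₙ : P l on side j
      Pₖ₋ₙ = trans (sym (·⨯-cycle (p j) (p (j ℤ.+ 1ℤ)) (p l)))
        (collinear-swap (p (j ℤ.+ 1ℤ)) (p j) (p l) (collinear₂ j))
      P₋ₙ : P (j ℤ.- + n) on side j
      P₋ₙ = Equivalence.to
        (same-line (U·U⨯V≈0 (p j) (p (j ℤ.+ 1ℤ))) Pₖ₋ₙ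
          (subst (λ x → P x #ₕ P l) (ℤ.+-identityʳ j) 0#k-n) (edge j) (p (j ℤ.- + n)))
        (collinear-swap (p j) (p (j ℤ.- + n)) (p l) (collinear₁ j))

  -- Incidences between two spirals, expressed as minors.

  module Pair {k n : ℕ} {P Q : ℤ → Point} (generic : IsGenericPair k n P Q) where

    open IsGenericPair generic
    private
      module P = IsGenericSpiral genericP
      module Q = IsGenericSpiral genericQ

    Inscribed : ℤ → Set ℓ₁
    Inscribed j = Q j on sideP j

    p q : ℤ → Triple
    p j = coords (P j)
    q j = coords (sideQ j)

    -- One interface for all four offsets lets the argument run with them in any order.
    record Offset (a : ℤ) : Set (c Level.⊔ ℓ₁ Level.⊔ ℓ₂) where
      field
        vertex       : ∀ j → P (j ℤ.+ a) on sideP j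
        side         : ∀ j → Q j on sideQ (j ℤ.- a)
        vertex-apart : ∀ j → Q j #ₕ P (j ℤ.+ a)
        side-apart   : ∀ j → sideP j #ₕ sideQ (j ℤ.- a)

    record Separated (a b : ℤ) : Set ℓ₂ where
      constructor separated
      field
        vertices : ∀ j → P (j ℤ.+ a) #ₕ P (j ℤ.+ b)
        sides    : ∀ j → sideQ (j ℤ.- a) #ₕ sideQ (j ℤ.- b)

    Separated-sym : ∀ {a b} → Separated a b → Separated b a
    Separated-sym s = separated
      (λ j → ⨯-NonZero-sym _ _ (vertices j)) (λ j → ⨯-NonZero-sym _ _ (sides j))
      where open Separated s

    all-Offset : All Offset (offsets k n)
    all-Offset = All.zipWith (λ ((v , s) , (v# , s#)) → record
      { vertex       = v
      -- The dual incidence is `vertices-on-side` for `Q`, read at index `j - a`.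
      ; side         = λ j → subst (λ x → Q x on sideQ (j ℤ.- _)) (eq j _) (s (j ℤ.- _))
      ; vertex-apart = v#
      ; side-apart   = s#
      }) ( All.zip ( all-∀ (Incidences.vertices-on-side genericP)
                   , all-∀ (Incidences.vertices-on-side genericQ))
         , All.zip (all-∀ vertices-apart , all-∀ sides-apart))
      where
      eq : ∀ j a → j ℤ.- a ℤ.+ a ≡ j
      eq = solve-∀

    allPairs-Separated : AllPairs Separated (offsets k n)
    allPairs-Separated = AllPairs.zipWith (λ (v , s) → separated v s)
      (allPairs-∀ P.vertices-distinct , allPairs-∀ Q.sides-distinct)

    -- `Q j` is the meet of the sides of `Q` at `j - b` and `j - a`, and `sideP j` the join of
    -- `P (j + d)` and `P (j + c)`. Indices enter through equations so that entries of different
    -- minors can be identified.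
    inscribed⇔minor : ∀ {a b c d} → Offset a → Offset b → Offset c → Offset d →
      Separated a b → Separated c d →
      ∀ {j r s u v} → j ℤ.- b ≡ r → j ℤ.- a ≡ s → j ℤ.+ d ≡ u → j ℤ.+ c ≡ v →
      Inscribed j ⇔ q r · p u * (q s · p v) ≈ q r · p v * (q s · p u)
    inscribed⇔minor oa ob oc od a#b c#d {j} ≡.refl ≡.refl ≡.refl ≡.refl =
      incident⇔minor (sides (Separated-sym a#b) j) (vertices (Separated-sym c#d) j)
        (nonZero (Q j)) (nonZero (sideP j)) (side ob j) (side oa j) (vertex od j) (vertex oc j)
      where
      open Offset
      open Separated

    -- `sideP j` and `sideQ (j - a)` are distinct lines through `Q j`, so `P (j + b)`, another point
    -- of the former, is off the latter.
    inscribed⇒#0 : ∀ {a b} → Offset a → Offset b → ∀ {j r u} → j ℤ.- a ≡ r → j ℤ.+ b ≡ u →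
      Inscribed j → q r · p u # 0#
    inscribed⇒#0 {a} oa ob {j} ≡.refl ≡.refl inscribed =
      off-second-line inscribed (vertex ob j) (q (j ℤ.- a)) (vertex-apart ob j) (side-apart oa j) (side oa j)
      where open Offset

    module _ {a b c d} (oa : Offset a) (ob : Offset b) (oc : Offset c) (od : Offset d)
      (a#b : Separated a b) (a#c : Separated a c) (a#d : Separated a d)
      (b#c : Separated b c) (b#d : Separated b d) (c#d : Separated c d) (e : ℤ) where

      private
        f : ℤ
        f = e ℤ.+ (a ℤ.+ b ℤ.+ c ℤ.+ d)

        z : ℤ → ℤ → Carrier
        z x y = q (e ℤ.+ x) · p (f ℤ.- y)

        sum-last : ∀ e x y → e ℤ.+ (x ℤ.+ y) ℤ.- y ≡ e ℤ.+ x
        sum-last = solve-∀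
        sum-first : ∀ e x y → e ℤ.+ (x ℤ.+ y) ℤ.- x ≡ e ℤ.+ y
        sum-first = solve-∀

        -- For `j = e + x + y`, the sides at `j - y` and `j - x` are the rows `x` and `y` of `z`,
        -- and `f` makes `j + v` and `j + u` its columns `u` and `v`.
        minor : ∀ {x y u v} → Offset x → Offset y → Offset u → Offset v →
          Separated x y → Separated u v → f ≡ e ℤ.+ (x ℤ.+ y ℤ.+ u ℤ.+ v) →
          Inscribed (e ℤ.+ (x ℤ.+ y)) ⇔ z x u * z y v ≈ z x v * z y u
        minor {x} {y} {u} {v} ox oy ou ov x#y u#v f≡ =
          inscribed⇔minor ox oy ou ov x#y u#v (sum-last e x y) (sum-first e x y)
            (≡.trans (eq₁ e x y u v) (≡.cong (ℤ._- u) (≡.sym f≡)))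
            (≡.trans (eq₂ e x y u v) (≡.cong (ℤ._- v) (≡.sym f≡)))
          where
          eq₁ : ∀ e x y u v → e ℤ.+ (x ℤ.+ y) ℤ.+ v ≡ e ℤ.+ (x ℤ.+ y ℤ.+ u ℤ.+ v) ℤ.- u
          eq₁ = solve-∀
          eq₂ : ∀ e x y u v → e ℤ.+ (x ℤ.+ y) ℤ.+ u ≡ e ℤ.+ (x ℤ.+ y ℤ.+ u ℤ.+ v) ℤ.- v
          eq₂ = solve-∀

      sixth-inscribed :
        Inscribed (e ℤ.+ (c ℤ.+ d)) → Inscribed (e ℤ.+ (b ℤ.+ d)) → Inscribed (e ℤ.+ (a ℤ.+ c)) →
        Inscribed (e ℤ.+ (a ℤ.+ d)) → Inscribed (e ℤ.+ (b ℤ.+ c)) →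
        Inscribed (e ℤ.+ (a ℤ.+ b))
      sixth-inscribed cd bd ac ad bc = Equivalence.from (minor oa ob oc od a#b c#d ≡.refl) (sixth-minor
        -- Both entries to be cancelled belong to the minor at `c + d`, and that incidence shows
        -- them apart from zero.
        (inscribed⇒#0 od oa (sum-last e c d) (cb e a b c d) cd)
        (inscribed⇒#0 oc ob (sum-first e c d) (da e a b c d) cd)
        (Equivalence.to (minor oc od oa ob c#d a#b (cdab e a b c d)) cd)
        (Equivalence.to (minor ob od oa oc b#d a#c (bdac e a b c d)) bd)
        (Equivalence.to (minor oa oc ob od a#c b#d (acbd e a b c d)) ac)
        (Equivalence.to (minor oa od ob oc a#d b#c (adbc e a b c d)) ad)
        (Equivalence.to (minor ob oc oa od b#c a#d (bcad e a b c d)) bc))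
        where
        cb : ∀ e a b c d → e ℤ.+ (c ℤ.+ d) ℤ.+ a ≡ e ℤ.+ (a ℤ.+ b ℤ.+ c ℤ.+ d) ℤ.- b
        cb = solve-∀
        da : ∀ e a b c d → e ℤ.+ (c ℤ.+ d) ℤ.+ b ≡ e ℤ.+ (a ℤ.+ b ℤ.+ c ℤ.+ d) ℤ.- a
        da = solve-∀
        cdab : ∀ e a b c d → e ℤ.+ (a ℤ.+ b ℤ.+ c ℤ.+ d) ≡ e ℤ.+ (c ℤ.+ d ℤ.+ a ℤ.+ b)
        cdab = solve-∀
        bdac : ∀ e a b c d → e ℤ.+ (a ℤ.+ b ℤ.+ c ℤ.+ d) ≡ e ℤ.+ (b ℤ.+ d ℤ.+ a ℤ.+ c)
        bdac = solve-∀
        acbd : ∀ e a b c d → e ℤ.+ (a ℤ.+ b ℤ.+ c ℤ.+ d) ≡ e ℤ.+ (a ℤ.+ c ℤ.+ b ℤ.+ d)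
        acbd = solve-∀
        adbc : ∀ e a b c d → e ℤ.+ (a ℤ.+ b ℤ.+ c ℤ.+ d) ≡ e ℤ.+ (a ℤ.+ d ℤ.+ b ℤ.+ c)
        adbc = solve-∀
        bcad : ∀ e a b c d → e ℤ.+ (a ℤ.+ b ℤ.+ c ℤ.+ d) ≡ e ℤ.+ (b ℤ.+ c ℤ.+ a ℤ.+ d)
        bcad = solve-∀

  -- Moving a window of incidences along the spiral.

  module Propagation {k t : ℕ} {P Q : ℤ → Point}
    (generic : IsGenericPair k (suc (k ℕ.+ 2) ℕ.+ t) P Q) where

    open Pair generic

    private
      n : ℕ
      n = suc (k ℕ.+ 2) ℕ.+ t

    -- 2 n - k, one less than the length of a window.
    len : ℕ
    len = k ℕ.+ 6 ℕ.+ t ℕ.+ t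

    -- The pairwise sums of the offsets, shifted by v + len, are v , v + t + 3 ,
    -- v + t + 4 , v + k + 3 + t , v + k + 4 + t and v + len + 1.
    first⇔last : ∀ v → (∀ i → i ℕ.< len → Inscribed (v ℤ.+ + suc i)) →
      Inscribed (v ℤ.+ 0ℤ) ⇔ Inscribed (v ℤ.+ + suc len)
    first⇔last v inner with all-Offset | allPairs-Separated
    ... | o₀ ∷ o₁ ∷ o₋ₙ ∷ oₖ₋ₙ ∷ []
        | (s₀₁ ∷ s₀₋ₙ ∷ s₀ₖ₋ₙ ∷ []) ∷ (s₁₋ₙ ∷ s₁ₖ₋ₙ ∷ []) ∷ (s₋ₙₖ₋ₙ ∷ []) ∷ [] ∷ [] = mk⇔
      (λ first → subst Inscribed (≡.sym (last≡ v (+ k) (+ t)))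
        -- In this order the missing sum is `0 + 1`, the last index, and the complementary pair
        -- gives the first.
        (sixth-inscribed o₀ o₁ o₋ₙ oₖ₋ₙ s₀₁ s₀₋ₙ s₀ₖ₋ₙ s₁₋ₙ s₁ₖ₋ₙ s₋ₙₖ₋ₙ e
          (subst Inscribed (first≡ v (+ k) (+ t)) first)
          (subst Inscribed (k+4+t≡ v (+ k) (+ t)) at-k+4+t)
          (subst Inscribed (t+3≡ v (+ k) (+ t)) at-t+3)
          (subst Inscribed (k+3+t≡ v (+ k) (+ t)) at-k+3+t)
          (subst Inscribed (t+4≡ v (+ k) (+ t)) at-t+4)))
      (λ last → subst Inscribed (≡.sym (first≡ v (+ k) (+ t)))
        -- The two pairs trade places, so the first index becomes the missing one.
        (sixth-inscribed o₋ₙ oₖ₋ₙ o₀ o₁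
          s₋ₙₖ₋ₙ (Separated-sym s₀₋ₙ) (Separated-sym s₁₋ₙ) (Separated-sym s₀ₖ₋ₙ) (Separated-sym s₁ₖ₋ₙ) s₀₁ e
          (subst Inscribed (last≡ v (+ k) (+ t)) last)
          (swapped 1ℤ (+ k ℤ.- + n) (subst Inscribed (k+4+t≡ v (+ k) (+ t)) at-k+4+t))
          (swapped 0ℤ (ℤ.- + n) (subst Inscribed (t+3≡ v (+ k) (+ t)) at-t+3))
          (swapped 1ℤ (ℤ.- + n) (subst Inscribed (t+4≡ v (+ k) (+ t)) at-t+4))
          (swapped 0ℤ (+ k ℤ.- + n) (subst Inscribed (k+3+t≡ v (+ k) (+ t)) at-k+3+t))))
      where
      e = v ℤ.+ + len

      swapped : ∀ a b → Inscribed (e ℤ.+ (a ℤ.+ b)) → Inscribed (e ℤ.+ (b ℤ.+ a))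
      swapped a b = subst (λ s → Inscribed (e ℤ.+ s)) (ℤ.+-comm a b)

      -- The slack `r` turns the bound into an identity for the ring solver.
      at : ∀ i r → suc i ℕ.+ r ≡ len → Inscribed (v ℤ.+ + suc i)
      at i r i+r≡len = inner i (subst (suc i ℕ.≤_) i+r≡len (ℕ.m≤m+n (suc i) r))

      at-t+3   = at (t ℕ.+ 2) (k ℕ.+ t ℕ.+ 3) (eq k t)
        where
        eq : ∀ k t → suc (t ℕ.+ 2) ℕ.+ (k ℕ.+ t ℕ.+ 3) ≡ k ℕ.+ 6 ℕ.+ t ℕ.+ t
        eq = ℕ-Solver.solve-∀
      at-t+4   = at (t ℕ.+ 3) (k ℕ.+ t ℕ.+ 2) (eq k t)
        where
        eq : ∀ k t → suc (t ℕ.+ 3) ℕ.+ (k ℕ.+ t ℕ.+ 2) ≡ k ℕ.+ 6 ℕ.+ t ℕ.+ t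
        eq = ℕ-Solver.solve-∀
      at-k+3+t = at (k ℕ.+ 2 ℕ.+ t) (t ℕ.+ 3) (eq k t)
        where
        eq : ∀ k t → suc (k ℕ.+ 2 ℕ.+ t) ℕ.+ (t ℕ.+ 3) ≡ k ℕ.+ 6 ℕ.+ t ℕ.+ t
        eq = ℕ-Solver.solve-∀
      at-k+4+t = at (k ℕ.+ 3 ℕ.+ t) (t ℕ.+ 2) (eq k t)
        where
        eq : ∀ k t → suc (k ℕ.+ 3 ℕ.+ t) ℕ.+ (t ℕ.+ 2) ≡ k ℕ.+ 6 ℕ.+ t ℕ.+ t
        eq = ℕ-Solver.solve-∀

      -- Here and below `n` and `len` are expanded: `+_` commutes with addition by computation, so
      -- the instances at `+ k` and `+ t` have the required type definitionally.
      first≡ : ∀ v k t → v ℤ.+ 0ℤ ≡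
        v ℤ.+ (k ℤ.+ + 6 ℤ.+ t ℤ.+ t) ℤ.+
          (ℤ.- (+ 1 ℤ.+ (k ℤ.+ + 2) ℤ.+ t) ℤ.+ (k ℤ.- (+ 1 ℤ.+ (k ℤ.+ + 2) ℤ.+ t)))
      first≡ = solve-∀
      t+3≡ : ∀ v k t → v ℤ.+ (+ 1 ℤ.+ (t ℤ.+ + 2)) ≡
        v ℤ.+ (k ℤ.+ + 6 ℤ.+ t ℤ.+ t) ℤ.+ (0ℤ ℤ.+ ℤ.- (+ 1 ℤ.+ (k ℤ.+ + 2) ℤ.+ t))
      t+3≡ = solve-∀
      t+4≡ : ∀ v k t → v ℤ.+ (+ 1 ℤ.+ (t ℤ.+ + 3)) ≡
        v ℤ.+ (k ℤ.+ + 6 ℤ.+ t ℤ.+ t) ℤ.+ (1ℤ ℤ.+ ℤ.- (+ 1 ℤ.+ (k ℤ.+ + 2) ℤ.+ t))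
      t+4≡ = solve-∀
      k+3+t≡ : ∀ v k t → v ℤ.+ (+ 1 ℤ.+ (k ℤ.+ + 2 ℤ.+ t)) ≡
        v ℤ.+ (k ℤ.+ + 6 ℤ.+ t ℤ.+ t) ℤ.+ (0ℤ ℤ.+ (k ℤ.- (+ 1 ℤ.+ (k ℤ.+ + 2) ℤ.+ t)))
      k+3+t≡ = solve-∀
      k+4+t≡ : ∀ v k t → v ℤ.+ (+ 1 ℤ.+ (k ℤ.+ + 3 ℤ.+ t)) ≡
        v ℤ.+ (k ℤ.+ + 6 ℤ.+ t ℤ.+ t) ℤ.+ (1ℤ ℤ.+ (k ℤ.- (+ 1 ℤ.+ (k ℤ.+ + 2) ℤ.+ t)))
      k+4+t≡ = solve-∀
      last≡ : ∀ v k t → v ℤ.+ (+ 1 ℤ.+ (k ℤ.+ + 6 ℤ.+ t ℤ.+ t)) ≡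
        v ℤ.+ (k ℤ.+ + 6 ℤ.+ t ℤ.+ t) ℤ.+ (0ℤ ℤ.+ 1ℤ)
      last≡ = solve-∀

    Window : ℤ → Set ℓ₁
    Window w = ∀ i → i ℕ.< suc len → Inscribed (w ℤ.+ + i)

    next : ∀ w → Window w → Window (w ℤ.+ 1ℤ)
    next w window i i<1+len = subst Inscribed (≡.sym (ℤ.+-assoc w 1ℤ (+ i)))
      (step (ℕ.m<1+n⇒m<n∨m≡n i<1+len))
      where
      step : i ℕ.< len ⊎ i ≡ len → Inscribed (w ℤ.+ + suc i)
      step (inj₁ i<len)  = window (suc i) (s≤s i<len)
      -- `w + len + 1` is the only index outside the old window.
      step (inj₂ ≡.refl) = Equivalence.to
        (first⇔last w (λ i i<len → window (suc i) (s≤s i<len))) (window 0 (s≤s z≤n))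

    -- The same window, counted from one place before its start.
    shifted : ∀ w → Window w → ∀ i → i ℕ.< suc len → Inscribed (w ℤ.- 1ℤ ℤ.+ + suc i)
    shifted w window i i<1+len = subst Inscribed (eq w (+ i)) (window i i<1+len)
      where
      eq : ∀ w i → w ℤ.+ i ≡ w ℤ.- 1ℤ ℤ.+ (1ℤ ℤ.+ i)
      eq = solve-∀

    previous : ∀ w → Window w → Window (w ℤ.- 1ℤ)
    previous w window zero    _           = Equivalence.from
      (first⇔last (w ℤ.- 1ℤ) (λ i i<len → shifted w window i (ℕ.m<n⇒m<1+n i<len)))
      (shifted w window len (ℕ.n<1+n len))
    previous w window (suc i) (s≤s i<len) = shifted w window i (ℕ.m<n⇒m<1+n i<len)

    windows : ∀ m → Window m → ∀ i → Window (m ℤ.+ i)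
    windows m window (+ zero)       = subst Window (≡.sym (ℤ.+-identityʳ m)) window
    windows m window (+ suc i)      = subst Window (eq m (+ i)) (next (m ℤ.+ + i) (windows m window (+ i)))
      where
      eq : ∀ m i → m ℤ.+ i ℤ.+ 1ℤ ≡ m ℤ.+ (1ℤ ℤ.+ i)
      eq = solve-∀
    windows m window -[1+ zero ]    = previous m window
    windows m window -[1+ suc i ]   = subst Window
      -- `-[1+ i ]` minus one computes to `-[1+ suc (i + 0) ]`, hence the right identity law.
      (≡.trans (ℤ.+-assoc m -[1+ i ] (ℤ.- 1ℤ)) (≡.cong (λ l → m ℤ.+ -[1+ suc l ]) (ℕ.+-identityʳ i)))
      (previous (m ℤ.+ -[1+ i ]) (windows m window -[1+ i ]))

    everywhere : ∀ m → Window m → ∀ j → Inscribed j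
    everywhere m window j = subst Inscribed (eq m j) (windows m window (j ℤ.- m) 0 (s≤s z≤n))
      where
      eq : ∀ m j → m ℤ.+ (j ℤ.- m) ℤ.+ 0ℤ ≡ j
      eq = solve-∀

open import Data.Nat.Base using (_+_; _*_; _∸_; _≤_; _<_)

mainTheorem7 : ∀ {c ℓ₁ ℓ₂} (F : HeytingField c ℓ₁ ℓ₂) →
    let open Plane F in
    (k n : ℕ) → 2 ≤ k → k + 2 < n →
    (P Q : ℤ → Point) (generic : IsGenericPair k n P Q) →
    let open IsGenericPair generic using (sideP) in
    (m : ℤ) →
    (∀ (i : ℕ) → i < 2 * n + 1 ∸ k → Q (m ℤ.+ + i) on sideP (m ℤ.+ + i)) →
    ∀ (j : ℤ) → Q j on sideP j
mainTheorem7 F k n _ k+2<n P Q generic m window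
  -- The strict inequality unfolds to `suc (k + 2) ≤ n`, which puts `n` into the form used by
  -- `Propagation`.
  with t , ≡.refl ← ℕ.m≤n⇒∃[o]m+o≡n k+2<n =
  everywhere m (λ i i<1+len → window i (subst (i <_) (≡.sym count) i<1+len))
  where
  open Spirals F
  open Propagation {k} {t} generic
  -- With `k` split off as a summand, the truncated subtraction in `count` is exact.
  eq : ∀ k t → 2 * (suc (k + 2) + t) + 1 ≡ suc (k + 6 + t + t) + k
  eq = ℕ-Solver.solve-∀
  count : 2 * n + 1 ∸ k ≡ suc len
  count = ≡.trans (≡.cong (_∸ k) (eq k t)) (ℕ.m+n∸n≡m (suc len) k)
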